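{- Let $m$ be an element of the monoid $M$. Then there exists a representative $w_0\in\Sigma^*$ of $m$ in which every pair of consecutive letters is of one of the forms: $c_ic_j$ with $i\ge j-1$; $c_it_{j\,j+1}$ with $i\ge j-1$; $t_{i\,i+1}c_j$ with $i\ge j-2$; or $t_{i\,i+1}t_{j\,j+1}$ with $i\ge j-2$. Furthermore: (i) this representative $w_0$ is unique, and it is the lexicographically maximal representative of $m$ with respect to the total order $c_1<t_{12}<c_2<t_{23}<c_3<\cdots$ on $\Sigma$; (ii) if $w_0$ starts with $c_1$ or $t_{12}$, then every representative $w\in\Sigma^*$ of $m$ starts with $c_1$ or $t_{12}$; (iii) if $w_0$ contains no factor of the form $c_ic_i$ ($i\ge1$), then no representative $w\in\Sigma^*$ of $m$ contains a factor of this form.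
   Context: Let $\Sigma=\{c_1,c_2,\dots\}\cup\{t_{12},t_{23},\dots,t_{i\,i+1},\dots\}$ be a countable alphabet, $\Sigma^*$ the free monoid on $\Sigma$, and $M$ the free partially commutative monoid obtained from $\Sigma^*$ by imposing the commutation relations $c_ic_j=c_jc_i$ if $|i-j|\ge2$; $c_it_{j\,j+1}=t_{j\,j+1}c_i$ if $i\le j-2$ or $i\ge j+3$; $t_{i\,i+1}t_{j\,j+1}=t_{j\,j+1}t_{i\,i+1}$ if $|i-j|\ge3$. A representative of $m\in M$ is a word in $\Sigma^*$ whose image in $M$ is $m$ (all representatives have the same length). A factor of a word is a block of consecutive letters. -}

module Defs where

open import Algebra.Bundles using (Monoid)
open import Data.List using (List; []; _∷_; _++_; head)
open import Data.List.Properties using (++-assoc; ++-identityʳ)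
open import Data.List.Relation.Binary.Infix.Heterogeneous using (Infix)
open import Data.List.Relation.Binary.Lex.Strict using (Lex-≤)
open import Data.List.Relation.Unary.Linked using (Linked)
open import Data.Maybe using (just)
open import Data.Nat using (ℕ; _+_; _*_; _≤_; _<_; _≥_; ∣_-_∣; NonZero)
open import Data.Product using (_×_; _,_)
open import Data.Sum using (_⊎_)
open import Function using (_on_)
open import Level using (0ℓ)
open import Relation.Binary using (Rel)
open import Relation.Binary.PropositionalEquality using (_≡_; refl)
open import Relation.Nullary using (¬_)

-- Indices start at 1; t i stands for t_{i i+1}.
data Letter : Set where
  c : (i : ℕ) .{{_ : NonZero i}} → Letter
  t : (i : ℕ) .{{_ : NonZero i}} → Letter

Word : Set
Word = List Letter

-- Here and in Allowed, inequalities are rearranged so that no truncated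
-- subtraction occurs, e.g. i ≤ j - 2 is written i + 2 ≤ j.
data Commutation : Rel Letter 0ℓ where
  cc : ∀ {i j} .{{_ : NonZero i}} .{{_ : NonZero j}} →
       ∣ i - j ∣ ≥ 2 → Commutation (c i) (c j)
  ct : ∀ {i j} .{{_ : NonZero i}} .{{_ : NonZero j}} →
       i + 2 ≤ j ⊎ i ≥ j + 3 → Commutation (c i) (t j)
  tt : ∀ {i j} .{{_ : NonZero i}} .{{_ : NonZero j}} →
       ∣ i - j ∣ ≥ 3 → Commutation (t i) (t j)

infix 4 _≈_

-- The least monoid congruence on words containing the commutation relations.
data _≈_ : Rel Word 0ℓ where
  comm    : ∀ {a b} → Commutation a b → a ∷ b ∷ [] ≈ b ∷ a ∷ []
  ++-cong : ∀ {u u′ v v′} → u ≈ u′ → v ≈ v′ → u ++ v ≈ u′ ++ v′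
  ≈-refl  : ∀ {u} → u ≈ u
  ≈-sym   : ∀ {u v} → u ≈ v → v ≈ u
  ≈-trans : ∀ {u v w} → u ≈ v → v ≈ w → u ≈ w

≡⇒≈ : ∀ {u v} → u ≡ v → u ≈ v
≡⇒≈ refl = ≈-refl

-- The quotient monoid as a setoid: its elements are words taken up to _≈_.
M : Monoid 0ℓ 0ℓ
M = record
  { Carrier  = Word
  ; _≈_      = _≈_
  ; _∙_      = _++_
  ; ε        = []
  ; isMonoid = record
    { isSemigroup = record
      { isMagma = record
        { isEquivalence = record { refl = ≈-refl ; sym = ≈-sym ; trans = ≈-trans }
        ; ∙-cong        = ++-cong
        }
      ; assoc = λ u v w → ≡⇒≈ (++-assoc u v w)
      }
    ; identity = (λ _ → ≈-refl) , (λ u → ≡⇒≈ (++-identityʳ u))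
    }
  }

-- The canonical projection Σ* → M.
image : Word → Monoid.Carrier M
image w = w

_Represents_ : Word → Monoid.Carrier M → Set
w Represents m = Monoid._≈_ M (image w) m

data Allowed : Rel Letter 0ℓ where
  cc : ∀ {i j} .{{_ : NonZero i}} .{{_ : NonZero j}} →
       i + 1 ≥ j → Allowed (c i) (c j)
  ct : ∀ {i j} .{{_ : NonZero i}} .{{_ : NonZero j}} →
       i + 1 ≥ j → Allowed (c i) (t j)
  tc : ∀ {i j} .{{_ : NonZero i}} .{{_ : NonZero j}} →
       i + 2 ≥ j → Allowed (t i) (c j)
  tt : ∀ {i j} .{{_ : NonZero i}} .{{_ : NonZero j}} →
       i + 2 ≥ j → Allowed (t i) (t j)

ConsecutiveAllowed : Word → Set
ConsecutiveAllowed = Linked Allowed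

-- Ranks the letters along the chain c₁ < t₁₂ < c₂ < t₂₃ < c₃ < ⋯.
rank : Letter → ℕ
rank (c i) = 2 * i
rank (t i) = 2 * i + 1

_<ₗ_ : Rel Letter 0ℓ
_<ₗ_ = _<_ on rank

_≤lex_ : Rel Word 0ℓ
_≤lex_ = Lex-≤ _≡_ _<ₗ_

LexMaximalRepresentative : Monoid.Carrier M → Word → Set
LexMaximalRepresentative m w₀ =
  w₀ Represents m × (∀ w → w Represents m → w ≤lex w₀)

StartsWithC₁OrT₁₂ : Word → Set
StartsWithC₁OrT₁₂ w = head w ≡ just (c 1) ⊎ head w ≡ just (t 1)

NoFactorCᵢCᵢ : Word → Set
NoFactorCᵢCᵢ w = ∀ i .{{_ : NonZero i}} → ¬ Infix _≡_ (c i ∷ c i ∷ []) w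

{-# OPTIONS --safe #-}

-- Attach to c i the interval [i , i + 2) and to t i the interval [i , i + 3).
-- Two letters commute iff their intervals are disjoint, and a pair a b is
-- forbidden iff the interval of a lies entirely to the left of that of b
-- (written a ≺ b).  Hence a forbidden pair is exactly a commuting pair in
-- increasing order.  Inserting a letter a at the front of a word, by moving it
-- right as long as the next letter b satisfies a ≺ b, creates no forbidden
-- pair.  Since ≺ is transitive, insertions of commuting letters commute, so
-- inserting the letters of a word one by one into the empty word gives a normal
-- form which depends only on its class.  Insertion can only increase a word
-- lexicographically, never moves a letter past c₁ or t₁₂, and never separates
-- two equal adjacent letters, which gives (i), (ii) and (iii).
module Submission where

open import Algebra.Bundles using (Monoid)
open import Data.List using ([]; _∷_; _++_; foldr)
open import Data.List.Properties using (foldr-++)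
open import Data.List.Relation.Binary.Infix.Heterogeneous using (Infix; here; there)
open import Data.List.Relation.Binary.Lex.Strict using (base; this; next)
open import Data.List.Relation.Binary.Prefix.Heterogeneous using ([]; _∷_)
open import Data.List.Relation.Unary.Linked using ([]; [-]; _∷_)
open import Data.Nat using (ℕ; zero; suc; _+_; _*_; _≤_; _<_; _≤?_; ∣_-_∣; z≤n; s≤s)
open import Data.Nat.Properties
open import Data.Product using (_×_; _,_; ∃-syntax)
open import Data.Sum as Sum using (_⊎_; inj₁; inj₂)
open import Relation.Binary using (Decidable; Transitive; Asymmetric)
open import Relation.Binary.PropositionalEquality using (_≡_; refl; sym; trans; cong; subst; module ≡-Reasoning)
open import Relation.Nullary using (¬_; yes; no; contradiction)
open import Defs

-- Intervals of letters.

left right : Letter → ℕ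
left (c i)  = i
left (t i)  = i
right (c i) = i + 2
right (t i) = i + 3

infix 4 _≺_ _≺?_

_≺_ : Letter → Letter → Set
a ≺ b = right a ≤ left b

_≺?_ : Decidable _≺_
a ≺? b = right a ≤? left b

left<right : ∀ a → left a < right a
left<right (c i) = m<m+n i (s≤s z≤n)
left<right (t i) = m<m+n i (s≤s z≤n)

1<right : ∀ a → 1 < right a
1<right (c i) = m≤n+m 2 i
1<right (t i) = ≤-trans (n≤1+n 2) (m≤n+m 3 i)

≺-trans : Transitive _≺_
≺-trans {j = b} a≺b b≺d = ≤-trans a≺b (≤-trans (<⇒≤ (left<right b)) b≺d)

≺-asym : Asymmetric _≺_
≺-asym {a} {b} a≺b b≺a =
  <⇒≱ (left<right a) (≺-trans {a} {b} {a} a≺b b≺a)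

rank<2*right : ∀ a → rank a < 2 * right a
rank<2*right (c i) = *-monoʳ-< 2 (left<right (c i))
rank<2*right (t i) = subst (2 * i + 1 <_) (sym (*-distribˡ-+ 2 i 3)) (+-monoʳ-< (2 * i) (s≤s (s≤s z≤n)))

2*left≤rank : ∀ a → 2 * left a ≤ rank a
2*left≤rank (c i) = ≤-refl
2*left≤rank (t i) = m≤m+n (2 * i) 1

-- Doubling the endpoints puts them on the scale of `rank`: `rank a < 2 * right a ≤ 2 * left b ≤
-- rank b`.
≺⇒<ₗ : ∀ {a b} → a ≺ b → a <ₗ b
≺⇒<ₗ {a} {b} a≺b = <-≤-trans (rank<2*right a) (≤-trans (*-monoʳ-≤ 2 a≺b) (2*left≤rank b))

apart⇒disjoint : ∀ i j k → k ≤ ∣ i - j ∣ → i + k ≤ j ⊎ j + k ≤ i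
apart⇒disjoint zero    j       k k≤ = inj₁ k≤
apart⇒disjoint (suc i) zero    k k≤ = inj₂ k≤
apart⇒disjoint (suc i) (suc j) k k≤ = Sum.map s≤s s≤s (apart⇒disjoint i j k k≤)

disjoint⇒apart : ∀ i j k → i + k ≤ j → k ≤ ∣ i - j ∣
disjoint⇒apart zero    j       k i+k≤j       = i+k≤j
disjoint⇒apart (suc i) (suc j) k (s≤s i+k≤j) = disjoint⇒apart i j k i+k≤j

Commutation⇒≺∨≻ : ∀ {a b} → Commutation a b → a ≺ b ⊎ b ≺ a
Commutation⇒≺∨≻ (cc {i} {j} apart) = apart⇒disjoint i j 2 apart
Commutation⇒≺∨≻ (ct disjoint)      = disjoint
Commutation⇒≺∨≻ (tt {i} {j} apart) = apart⇒disjoint i j 3 apart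

≺⇒comm : ∀ a b → a ≺ b → a ∷ b ∷ [] ≈ b ∷ a ∷ []
≺⇒comm (c i) (c j) a≺b = comm (cc (disjoint⇒apart i j 2 a≺b))
≺⇒comm (c i) (t j) a≺b = comm (ct (inj₁ a≺b))
≺⇒comm (t i) (c j) a≺b = ≈-sym (comm (ct (inj₂ a≺b)))
≺⇒comm (t i) (t j) a≺b = comm (tt (disjoint⇒apart i j 3 a≺b))

Allowed⇒⊀ : ∀ {a b} → Allowed a b → ¬ a ≺ b
Allowed⇒⊀ (cc {i} j≤i+1) a≺b = <⇒≱ (+-monoʳ-< i ≤-refl) (≤-trans a≺b j≤i+1)
Allowed⇒⊀ (ct {i} j≤i+1) a≺b = <⇒≱ (+-monoʳ-< i ≤-refl) (≤-trans a≺b j≤i+1)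
Allowed⇒⊀ (tc {i} j≤i+2) a≺b = <⇒≱ (+-monoʳ-< i ≤-refl) (≤-trans a≺b j≤i+2)
Allowed⇒⊀ (tt {i} j≤i+2) a≺b = <⇒≱ (+-monoʳ-< i ≤-refl) (≤-trans a≺b j≤i+2)

-- Explains why interval lengths 2 and 3 correspond to the bounds `i + 1` and `i + 2` in `Allowed`.
≰+suc⇒≤+ : ∀ i j k → ¬ i + suc k ≤ j → j ≤ i + k
≰+suc⇒≤+ i j k ≰ = m<1+n⇒m≤n (subst (j <_) (+-suc i k) (≰⇒> ≰))

⊀⇒Allowed : ∀ a b → ¬ a ≺ b → Allowed a b
⊀⇒Allowed (c i) (c j) a⊀b = cc (≰+suc⇒≤+ i j 1 a⊀b)
⊀⇒Allowed (c i) (t j) a⊀b = ct (≰+suc⇒≤+ i j 1 a⊀b)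
⊀⇒Allowed (t i) (c j) a⊀b = tc (≰+suc⇒≤+ i j 2 a⊀b)
⊀⇒Allowed (t i) (t j) a⊀b = tt (≰+suc⇒≤+ i j 2 a⊀b)

-- Insertion of a letter.

insert : Letter → Word → Word
insert a []      = a ∷ []
insert a (b ∷ w) with a ≺? b
... | yes _ = b ∷ insert a w
... | no  _ = a ∷ b ∷ w

insert-≺ : ∀ {a b} w → a ≺ b → insert a (b ∷ w) ≡ b ∷ insert a w
insert-≺ {a} {b} w a≺b with a ≺? b
... | yes _   = refl
... | no  a⊀b = contradiction a≺b a⊀b

insert-⊀ : ∀ {a b} w → ¬ a ≺ b → insert a (b ∷ w) ≡ a ∷ b ∷ w
insert-⊀ {a} {b} w a⊀b with a ≺? b
... | yes a≺b = contradiction a≺b a⊀b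
... | no  _   = refl

insert-≈ : ∀ a w → insert a w ≈ a ∷ w
insert-≈ a []      = ≈-refl
insert-≈ a (b ∷ w) with a ≺? b
... | yes a≺b = ≈-trans (++-cong {b ∷ []} ≈-refl (insert-≈ a w))
                        (++-cong {v = w} (≈-sym (≺⇒comm a b a≺b)) ≈-refl)
... | no  _   = ≈-refl

-- Compare both letters with the head `d`. Once `b` stops, `a` jumps over it, whereas `b` never
-- jumps over `a`; so both orders leave `b` in front of `a`.
insert-comm-≺ : ∀ {a b} → a ≺ b → ∀ w → insert a (insert b w) ≡ insert b (insert a w)
insert-comm-≺ {a} {b} a≺b [] =
  trans (insert-≺ [] a≺b) (sym (insert-⊀ [] (≺-asym {a} {b} a≺b)))
insert-comm-≺ {a} {b} a≺b (d ∷ w) with b ≺? d | a ≺? d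
... | yes b≺d | yes a≺d = begin
  insert a (d ∷ insert b w) ≡⟨ insert-≺ _ a≺d ⟩
  d ∷ insert a (insert b w) ≡⟨ cong (d ∷_) (insert-comm-≺ a≺b w) ⟩
  d ∷ insert b (insert a w) ≡⟨ insert-≺ _ b≺d ⟨
  insert b (d ∷ insert a w) ∎
  where open ≡-Reasoning
... | yes b≺d | no  a⊀d = contradiction (≺-trans {a} {b} {d} a≺b b≺d) a⊀d
... | no  b⊀d | yes a≺d = begin
  insert a (b ∷ d ∷ w)      ≡⟨ insert-≺ _ a≺b ⟩
  b ∷ insert a (d ∷ w)      ≡⟨ cong (b ∷_) (insert-≺ w a≺d) ⟩
  b ∷ d ∷ insert a w        ≡⟨ insert-⊀ _ b⊀d ⟨
  insert b (d ∷ insert a w) ∎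
  where open ≡-Reasoning
... | no  b⊀d | no  a⊀d = begin
  insert a (b ∷ d ∷ w) ≡⟨ insert-≺ _ a≺b ⟩
  b ∷ insert a (d ∷ w) ≡⟨ cong (b ∷_) (insert-⊀ w a⊀d) ⟩
  b ∷ a ∷ d ∷ w        ≡⟨ insert-⊀ _ (≺-asym {a} {b} a≺b) ⟨
  insert b (a ∷ d ∷ w) ∎
  where open ≡-Reasoning

insert-comm : ∀ {a b} → Commutation a b → ∀ w → insert a (insert b w) ≡ insert b (insert a w)
insert-comm ab w with Commutation⇒≺∨≻ ab
... | inj₁ a≺b = insert-comm-≺ a≺b w
... | inj₂ b≺a = sym (insert-comm-≺ b≺a w)

-- Keeping the letter `b` just passed makes the induction work: wherever `a` stops, the new pair
-- `b a` is allowed because `a ≺ b` rules out `b ≺ a`.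
insert-allowed-after : ∀ {a b} w → a ≺ b → ConsecutiveAllowed (b ∷ w) → ConsecutiveAllowed (b ∷ insert a w)
insert-allowed-after {a} {b} []      a≺b _        = ⊀⇒Allowed b a (≺-asym {a} {b} a≺b) ∷ [-]
insert-allowed-after {a} {b} (d ∷ w) a≺b (bd ∷ l) with a ≺? d
... | yes a≺d = bd ∷ insert-allowed-after w a≺d l
... | no  a⊀d = ⊀⇒Allowed b a (≺-asym {a} {b} a≺b) ∷ ⊀⇒Allowed a d a⊀d ∷ l

insert-allowed : ∀ a w → ConsecutiveAllowed w → ConsecutiveAllowed (insert a w)
insert-allowed a []      l = [-]
insert-allowed a (b ∷ w) l with a ≺? b
... | yes a≺b = insert-allowed-after w a≺b l
... | no  a⊀b = ⊀⇒Allowed a b a⊀b ∷ l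

-- If `a` moves at all, the new first letter is already larger; otherwise the comparison passes to
-- the tails.
insert-≤lex : ∀ a {v} w → v ≤lex w → (a ∷ v) ≤lex insert a w
insert-≤lex a []      v≤w = next refl v≤w
insert-≤lex a (b ∷ w) v≤w with a ≺? b
... | yes a≺b = this (≺⇒<ₗ {a} {b} a≺b)
... | no  _   = next refl v≤w

left≡1⇒⊀ : ∀ a {b} → left b ≡ 1 → ¬ a ≺ b
left≡1⇒⊀ a eq a≺b = <⇒≱ (1<right a) (subst (right a ≤_) eq a≺b)

-- Had `a` passed the head `b`, the result would start with `b`, whose interval starts at 1, and
-- every right end exceeds 1. So `a` itself is the first letter.
insert-start : ∀ a w {v} → StartsWithC₁OrT₁₂ (insert a w) → StartsWithC₁OrT₁₂ (a ∷ v)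
insert-start a []      start = start
insert-start a (b ∷ w) start with a ≺? b | start
... | yes a≺b | inj₁ refl = contradiction a≺b (left≡1⇒⊀ a {b} refl)
... | yes a≺b | inj₂ refl = contradiction a≺b (left≡1⇒⊀ a {b} refl)
... | no  _   | inj₁ refl = inj₁ refl
... | no  _   | inj₂ refl = inj₂ refl

HasSquare : Letter → Word → Set
HasSquare x = Infix _≡_ (x ∷ x ∷ [])

-- Both copies pass the same letters, and the second stops right before the first since `x ≺ x`
-- fails.
insert-square : ∀ x w → HasSquare x (insert x (insert x w))
insert-square x [] = subst (HasSquare x)
  (sym (insert-⊀ [] (<⇒≱ (left<right x)))) (here (refl ∷ refl ∷ []))
insert-square x (b ∷ w) with x ≺? b
... | yes x≺b = subst (HasSquare x) (sym (insert-≺ _ x≺b)) (there (insert-square x w))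
... | no  _   = subst (HasSquare x)
  (sym (insert-⊀ _ (<⇒≱ (left<right x)))) (here (refl ∷ refl ∷ []))

-- The only danger is `a` landing between the two copies, but a letter that passes the first also
-- passes the second.
insert-preserves-square : ∀ {x} a w → HasSquare x w → HasSquare x (insert a w)
insert-preserves-square a []      (here ())
insert-preserves-square a (b ∷ w) sq with a ≺? b
... | no  _ = there sq
insert-preserves-square a (b ∷ w)     (there sq)                | yes _   =
  there (insert-preserves-square a w sq)
insert-preserves-square a (_ ∷ _ ∷ w) (here (refl ∷ refl ∷ [])) | yes a≺x =
  subst (λ v → HasSquare _ (_ ∷ v)) (sym (insert-≺ w a≺x)) (here (refl ∷ refl ∷ []))

-- Normal forms.

insertAll : Word → Word → Word
insertAll u v = foldr insert v u

-- The start word `w` is arbitrary because in the case `++-cong` the left factor acts on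
-- `insertAll v′ w`.
insertAll-cong : ∀ {u v} → u ≈ v → ∀ w → insertAll u w ≡ insertAll v w
insertAll-cong (comm ab) w = insert-comm ab w
insertAll-cong (++-cong {u} {u′} {v} {v′} u≈u′ v≈v′) w = begin
  insertAll (u ++ v) w          ≡⟨ foldr-++ insert w u v ⟩
  insertAll u (insertAll v w)   ≡⟨ cong (insertAll u) (insertAll-cong v≈v′ w) ⟩
  insertAll u (insertAll v′ w)  ≡⟨ insertAll-cong u≈u′ _ ⟩
  insertAll u′ (insertAll v′ w) ≡⟨ foldr-++ insert w u′ v′ ⟨
  insertAll (u′ ++ v′) w        ∎
  where open ≡-Reasoning
insertAll-cong ≈-refl            w = refl
insertAll-cong (≈-sym v≈u)       w = sym (insertAll-cong v≈u w)
insertAll-cong (≈-trans u≈x x≈v) w = trans (insertAll-cong u≈x w) (insertAll-cong x≈v w)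

normalForm : Word → Word
normalForm w = insertAll w []

normalForm-cong : ∀ {u v} → u ≈ v → normalForm u ≡ normalForm v
normalForm-cong u≈v = insertAll-cong u≈v []

normalForm-≈ : ∀ w → normalForm w ≈ w
normalForm-≈ []      = ≈-refl
normalForm-≈ (a ∷ w) = ≈-trans (insert-≈ a (normalForm w)) (++-cong {a ∷ []} ≈-refl (normalForm-≈ w))

normalForm-allowed : ∀ w → ConsecutiveAllowed (normalForm w)
normalForm-allowed []      = []
normalForm-allowed (a ∷ w) = insert-allowed a (normalForm w) (normalForm-allowed w)

-- Each letter is inserted before a tail that is already fixed, and stops at once because an allowed
-- pair is not in the relation `≺`.
normalForm-fixed : ∀ {w} → ConsecutiveAllowed w → normalForm w ≡ w
normalForm-fixed []  = refl
normalForm-fixed [-] = refl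
normalForm-fixed {a ∷ b ∷ _} (ab ∷ l) =
  trans (cong (insert a) (normalForm-fixed l)) (insert-⊀ {a} {b} _ (Allowed⇒⊀ ab))

≤lex-normalForm : ∀ w → w ≤lex normalForm w
≤lex-normalForm []      = base _
≤lex-normalForm (a ∷ w) = insert-≤lex a (normalForm w) (≤lex-normalForm w)

normalForm-start : ∀ w → StartsWithC₁OrT₁₂ (normalForm w) → StartsWithC₁OrT₁₂ w
normalForm-start []      start = start
normalForm-start (a ∷ w) start = insert-start a (normalForm w) {w} start

normalForm-preserves-square : ∀ {x} w → HasSquare x w → HasSquare x (normalForm w)
normalForm-preserves-square (_ ∷ _ ∷ w) (here (refl ∷ refl ∷ [])) = insert-square _ (normalForm w)
normalForm-preserves-square (a ∷ w)     (there sq) =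
  insert-preserves-square a (normalForm w) (normalForm-preserves-square w sq)

theorem3p12 : (m : Monoid.Carrier M) →
    ∃[ w₀ ] ( w₀ Represents m
    × ConsecutiveAllowed w₀
    × (∀ w → w Represents m → ConsecutiveAllowed w → w ≡ w₀)
    × LexMaximalRepresentative m w₀
    × (StartsWithC₁OrT₁₂ w₀ → ∀ w → w Represents m → StartsWithC₁OrT₁₂ w)
    × (NoFactorCᵢCᵢ w₀ → ∀ w → w Represents m → NoFactorCᵢCᵢ w))
theorem3p12 m =
    normalForm m
  , normalForm-≈ m
  , normalForm-allowed m
  -- Such a `w` is its own normal form, which is also that of `m`.
  , (λ w w≈m l → trans (sym (normalForm-fixed l)) (normalForm-cong w≈m))
  , (normalForm-≈ m , λ w w≈m → subst (w ≤lex_) (normalForm-cong w≈m) (≤lex-normalForm w))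
  , (λ start w w≈m → normalForm-start w (subst StartsWithC₁OrT₁₂ (sym (normalForm-cong w≈m)) start))
  , (λ none w w≈m i sq → none i (subst (HasSquare (c i)) (normalForm-cong w≈m) (normalForm-preserves-square w sq)))
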